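{- Let $k$ be a positive integer and $n\ge 0$ an integer. Let $M_n^{(k)}$, $J_n^{(k)}$ and $j_n^{(k)}$ be the $n$th higher order Mersenne, Jacobsthal and Jacobsthal-Lucas numbers, respectively. Then: 1. If $n$ is even, then $M_n^{(k)}=J_n^{(k)}$ if $k$ is even, and $M_n^{(k)}=\left(\frac{2^k+1}{2^k-1}\right)J_n^{(k)}$ if $k$ is odd. 2. If $n$ is odd, then $M_n^{(k)}=J_n^{(k)}$ if $k$ is even, and $M_n^{(k)}=j_n^{(k)}$ if $k$ is odd. 3. $M_n^{(2k)}=J_n^{(k)}j_n^{(k)}$.
   Context: The Mersenne numbers $\{M_n\}_{n\ge 0}$ are defined by $M_0=0$, $M_1=1$, $M_{n+2}=3M_{n+1}-2M_n$, i.e. $M_n=2^n-1$. For a positive integer $k$, the higher order Mersenne numbers are $M_n^{(k)}=M_{kn}/M_k$ for $n=0,1,2,\dots$. The higher order Jacobsthal numbers and higher order Jacobsthal-Lucas numbers are given (for positive integers $k$ and $n\ge 0$) by $$J_n^{(k)}=\frac{(2^k)^n-\left((-1)^k\right)^n}{2^k-(-1)^k},\qquad j_n^{(k)}=\frac{(2^k)^n+\left((-1)^k\right)^n}{2^k+(-1)^k}.$$ -}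

module Defs where

open import Data.Nat.Base as ℕ using (ℕ; zero; suc; NonZero)
import Data.Nat.Properties as ℕ
open import Data.Nat.Coprimality as Coprime using (1-coprimeTo)
open import Data.Integer.Base using (ℤ; +_; _+_; _-_; _*_; -_; _^_; ∣_∣; 0ℤ; 1ℤ; -1ℤ)
import Data.Integer.Base as ℤ
import Data.Integer.Properties as ℤ
open import Data.Integer.Tactic.RingSolver using (solve-∀)
open import Data.Rational.Base using (ℚ; mkℚ; _÷_)
open import Relation.Binary.PropositionalEquality
  using (_≡_; _≢_; refl; sym; trans; cong; cong₂; subst)

fromℤ : ℤ → ℚ
fromℤ i = mkℚ i 0 (Coprime.sym (1-coprimeTo ∣ i ∣))

-- The rational quotient of two integers; the library's _/_ into ℚ only
-- accepts natural-number denominators.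
infixl 7 _⁄_
_⁄_ : (a b : ℤ) .{{_ : ℤ.NonZero b}} → ℚ
(a ⁄ b) {{b≢0}} = (fromℤ a ÷ fromℤ b) {{b≢0}}

M : ℕ → ℤ
M 0             = 0ℤ
M 1             = 1ℤ
M (suc (suc n)) = + 3 * M (suc n) - + 2 * M n

M-closed : ∀ n → M n ≡ (+ 2) ^ n - 1ℤ
M-closed 0             = refl
M-closed 1             = refl
M-closed (suc (suc n)) =
  trans (cong₂ (λ x y → + 3 * x - + 2 * y) (M-closed (suc n)) (M-closed n))
        (step ((+ 2) ^ n))
  where
  step : ∀ x → + 3 * (+ 2 * x - 1ℤ) - + 2 * (x - 1ℤ) ≡ + 2 * (+ 2 * x) - 1ℤ
  step = solve-∀

∣i^n∣≡∣i∣^n : ∀ i n → ∣ i ^ n ∣ ≡ ∣ i ∣ ℕ.^ n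
∣i^n∣≡∣i∣^n i zero    = refl
∣i^n∣≡∣i∣^n i (suc n) =
  trans (ℤ.abs-* i (i ^ n)) (cong (∣ i ∣ ℕ.*_) (∣i^n∣≡∣i∣^n i n))

∣[-1]^n∣≡1 : ∀ n → ∣ -1ℤ ^ n ∣ ≡ 1
∣[-1]^n∣≡1 n = trans (∣i^n∣≡∣i∣^n -1ℤ n) (ℕ.^-zeroˡ n)

2^k-u≢0 : ∀ k .{{_ : NonZero k}} u → ∣ u ∣ ≡ 1 → ℤ.NonZero ((+ 2) ^ k - u)
2^k-u≢0 (suc k) u ∣u∣≡1 = ℤ.≢-nonZero λ eq →
  even≢1 (2 ℕ.^ k) (trans (sym (∣i^n∣≡∣i∣^n (+ 2) (suc k)))
    (trans (cong ∣_∣ (ℤ.i-j≡0⇒i≡j ((+ 2) ^ suc k) u eq)) ∣u∣≡1))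
  where
  even≢1 : ∀ m → 2 ℕ.* m ≢ 1
  even≢1 m eq with () ← ℕ.m*n≡1⇒m≡1 2 m eq

2^k-1≢0 : ∀ k .{{_ : NonZero k}} → ℤ.NonZero ((+ 2) ^ k - 1ℤ)
2^k-1≢0 k = 2^k-u≢0 k 1ℤ refl

M≢0 : ∀ k .{{_ : NonZero k}} → ℤ.NonZero (M k)
M≢0 k = subst ℤ.NonZero (sym (M-closed k)) (2^k-u≢0 k 1ℤ refl)

2^k-[-1]^k≢0 : ∀ k .{{_ : NonZero k}} → ℤ.NonZero ((+ 2) ^ k - -1ℤ ^ k)
2^k-[-1]^k≢0 k = 2^k-u≢0 k (-1ℤ ^ k) (∣[-1]^n∣≡1 k)

2^k+[-1]^k≢0 : ∀ k .{{_ : NonZero k}} → ℤ.NonZero ((+ 2) ^ k + -1ℤ ^ k)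
2^k+[-1]^k≢0 k =
  subst (λ v → ℤ.NonZero ((+ 2) ^ k + v)) (ℤ.neg-involutive (-1ℤ ^ k))
    (2^k-u≢0 k (- (-1ℤ ^ k)) (trans (ℤ.∣-i∣≡∣i∣ (-1ℤ ^ k)) (∣[-1]^n∣≡1 k)))

M⁽_⁾ : (k : ℕ) .{{_ : NonZero k}} → ℕ → ℚ
M⁽ k ⁾ n = (M (k ℕ.* n) ⁄ M k) {{M≢0 k}}

J⁽_⁾ : (k : ℕ) .{{_ : NonZero k}} → ℕ → ℚ
J⁽ k ⁾ n =
  ((((+ 2) ^ k) ^ n - (-1ℤ ^ k) ^ n) ⁄ ((+ 2) ^ k - -1ℤ ^ k)) {{2^k-[-1]^k≢0 k}}

j⁽_⁾ : (k : ℕ) .{{_ : NonZero k}} → ℕ → ℚ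
j⁽ k ⁾ n =
  ((((+ 2) ^ k) ^ n + (-1ℤ ^ k) ^ n) ⁄ ((+ 2) ^ k + -1ℤ ^ k)) {{2^k+[-1]^k≢0 k}}

{-# OPTIONS --safe #-}
module Submission where

open import Defs
open import Data.Nat.Base as ℕ using (ℕ; zero; suc; NonZero)
open import Data.Nat.Divisibility using (_∣_; _∤_; divides; _∣0; ∣-refl; ∣m∣n⇒∣m+n)
open import Data.Nat.Properties using (m*n≢0)
import Data.Nat.Properties as ℕ
open import Data.Integer.Base using (ℤ; +_; 1ℤ; -1ℤ; _+_; _-_; _^_)
import Data.Integer.Base as ℤ
import Data.Integer.Properties as ℤ
open import Data.Integer.Tactic.RingSolver using (solve-∀)
open import Data.Rational.Base using (ℚ; _*_; 1/_)
import Data.Rational.Properties as ℚ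
open import Algebra.Bundles using (CommutativeMonoid)
open import Algebra.Properties.CommutativeSemigroup
  (CommutativeMonoid.commutativeSemigroup ℚ.*-1-commutativeMonoid)
  using (interchange; xy∙z≈xz∙y)
open import Data.Product.Base using (_×_; _,_)
open import Relation.Nullary.Negation.Core using (contradiction)
open import Relation.Binary.PropositionalEquality
  using (_≡_; refl; sym; trans; cong; cong₂; module ≡-Reasoning)

open ≡-Reasoning

-- Write `x` for `2^k` and `u` for `(-1)^k`. The closed form of `M` turns the higher order Mersenne
-- number into `(x^n - 1)/(x - 1)`, to be compared with `(x^n - u^n)/(x - u)` and
-- `(x^n + u^n)/(x + u)`. For the first two claims, parity fixes `u` and `u^n` as signs: either
-- numerators and denominators agree outright (`⁄-cong`), or, for `k` odd and `n` even, only the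
-- denominators `x - 1` and `x + 1` differ, and the stated factor corrects for this (`⁄-cross`). The
-- third claim is the factorization of `x^2 - u^2`, where `u^2 = 1`, applied to numerator and
-- denominator alike (`M-double-factor-^`, `M-double-factor`).

fromℤ-* : ∀ a b → fromℤ (a ℤ.* b) ≡ fromℤ a * fromℤ b
-- With both denominators equal to 1, the rational product computes to `a ℤ.* b` over 1, put in
-- lowest terms.
fromℤ-* a b = sym (ℚ.↥p/↧p≡p (fromℤ (a ℤ.* b)))

⁄-*-cancel : ∀ a b .{{_ : ℤ.NonZero b}} → (a ⁄ b) * fromℤ b ≡ fromℤ a
⁄-*-cancel a b {{b≢0}} = begin
  fromℤ a * b⁻¹ * fromℤ b    ≡⟨ ℚ.*-assoc (fromℤ a) b⁻¹ (fromℤ b) ⟩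
  fromℤ a * (b⁻¹ * fromℤ b)  ≡⟨ cong (fromℤ a *_) (ℚ.*-inverseˡ (fromℤ b) {{b≢0}}) ⟩
  fromℤ a * fromℤ 1ℤ         ≡⟨ ℚ.*-identityʳ (fromℤ a) ⟩
  fromℤ a                    ∎
  where b⁻¹ = (1/ fromℤ b) {{b≢0}}

-- Together with `⁄-*-cancel` this characterizes a quotient by the product it satisfies, so that
-- identities between quotients reduce to identities between integers.
⁄-unique : ∀ {q} a b .{{_ : ℤ.NonZero b}} → q * fromℤ b ≡ fromℤ a → q ≡ a ⁄ b
⁄-unique {q} a b {{b≢0}} qb≡a = begin
  q                    ≡⟨ ℚ.*-identityʳ q ⟨
  q * fromℤ 1ℤ         ≡⟨ cong (q *_) (ℚ.*-inverseʳ (fromℤ b) {{b≢0}}) ⟨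
  q * (fromℤ b * b⁻¹)  ≡⟨ ℚ.*-assoc q (fromℤ b) b⁻¹ ⟨
  q * fromℤ b * b⁻¹    ≡⟨ cong (_* b⁻¹) qb≡a ⟩
  fromℤ a * b⁻¹        ∎
  where b⁻¹ = (1/ fromℤ b) {{b≢0}}

⁄-cross : ∀ a b c d .{{_ : ℤ.NonZero b}} .{{_ : ℤ.NonZero d}} →
          a ℤ.* d ≡ c ℤ.* b → a ⁄ b ≡ c ⁄ d
⁄-cross a b c d {{b≢0}} ad≡cb = ⁄-unique c d (begin
  fromℤ a * b⁻¹ * fromℤ d  ≡⟨ xy∙z≈xz∙y (fromℤ a) b⁻¹ (fromℤ d) ⟩
  fromℤ a * fromℤ d * b⁻¹  ≡⟨ cong (_* b⁻¹) (fromℤ-* a d) ⟨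
  (a ℤ.* d) ⁄ b            ≡⟨ cong (λ e → e ⁄ b) ad≡cb ⟩
  (c ℤ.* b) ⁄ b            ≡⟨ ⁄-unique (c ℤ.* b) b (sym (fromℤ-* c b)) ⟨
  fromℤ c                  ∎)
  where b⁻¹ = (1/ fromℤ b) {{b≢0}}

⁄-* : ∀ a b c d .{{_ : ℤ.NonZero b}} .{{_ : ℤ.NonZero d}} →
      (a ⁄ b) * (c ⁄ d) ≡ ((a ℤ.* c) ⁄ (b ℤ.* d)) {{ℤ.i*j≢0 b d}}
⁄-* a b c d = ⁄-unique (a ℤ.* c) (b ℤ.* d) {{ℤ.i*j≢0 b d}} (begin
  (a ⁄ b) * (c ⁄ d) * fromℤ (b ℤ.* d)        ≡⟨ cong ((a ⁄ b) * (c ⁄ d) *_) (fromℤ-* b d) ⟩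
  (a ⁄ b) * (c ⁄ d) * (fromℤ b * fromℤ d)    ≡⟨ interchange (a ⁄ b) (c ⁄ d) (fromℤ b) (fromℤ d) ⟩
  (a ⁄ b) * fromℤ b * ((c ⁄ d) * fromℤ d)    ≡⟨ cong₂ _*_ (⁄-*-cancel a b) (⁄-*-cancel c d) ⟩
  fromℤ a * fromℤ c                          ≡⟨ fromℤ-* a c ⟨
  fromℤ (a ℤ.* c)                            ∎)

-- Proofs that a denominator is nonzero are irrelevant, so two quotients carrying different such
-- proofs still coincide.
⁄-cong : ∀ {a b c d} .{{_ : ℤ.NonZero b}} .{{_ : ℤ.NonZero d}} →
         a ≡ c → b ≡ d → a ⁄ b ≡ c ⁄ d
⁄-cong refl refl = refl

[-1]^even : ∀ {n} → 2 ∣ n → -1ℤ ^ n ≡ 1ℤ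
[-1]^even (divides q refl) = begin
  -1ℤ ^ (q ℕ.* 2)   ≡⟨ cong (-1ℤ ^_) (ℕ.*-comm q 2) ⟩
  -- The base of `(-1ℤ ^ 2) ^ q` evaluates to `1ℤ`.
  -1ℤ ^ (2 ℕ.* q)   ≡⟨ ℤ.^-*-assoc -1ℤ 2 q ⟨
  1ℤ ^ q            ≡⟨ ℤ.^-zeroˡ q ⟩
  1ℤ                ∎

[-1]^odd : ∀ n → 2 ∤ n → -1ℤ ^ n ≡ -1ℤ
[-1]^odd zero          2∤0 = contradiction (2 ∣0) 2∤0
[-1]^odd (suc zero)    _   = refl
[-1]^odd (suc (suc n)) 2∤n =
  cong (λ u → -1ℤ ℤ.* (-1ℤ ℤ.* u)) ([-1]^odd n λ 2∣n → 2∤n (∣m∣n⇒∣m+n ∣-refl 2∣n))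

[-1]^n*[-1]^n≡1 : ∀ n → -1ℤ ^ n ℤ.* -1ℤ ^ n ≡ 1ℤ
[-1]^n*[-1]^n≡1 n = begin
  -1ℤ ^ n ℤ.* -1ℤ ^ n  ≡⟨ ℤ.^-distribˡ-+-* -1ℤ n n ⟨
  -1ℤ ^ (n ℕ.+ n)      ≡⟨ [-1]^even (divides n (trans (cong (n ℕ.+_) (sym (ℕ.+-identityʳ n))) (ℕ.*-comm 2 n))) ⟩
  1ℤ                   ∎

M-* : ∀ k n → M (k ℕ.* n) ≡ ((+ 2) ^ k) ^ n - 1ℤ
M-* k n = trans (M-closed (k ℕ.* n)) (cong (_- 1ℤ) (sym (ℤ.^-*-assoc (+ 2) k n)))

M-double : ∀ n → M (2 ℕ.* n) ≡ (+ 2) ^ n ℤ.* (+ 2) ^ n - 1ℤ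
M-double n = begin
  M (2 ℕ.* n)                     ≡⟨ M-closed (2 ℕ.* n) ⟩
  (+ 2) ^ (n ℕ.+ (n ℕ.+ 0)) - 1ℤ  ≡⟨ cong (λ m → (+ 2) ^ (n ℕ.+ m) - 1ℤ) (ℕ.+-identityʳ n) ⟩
  (+ 2) ^ (n ℕ.+ n) - 1ℤ          ≡⟨ cong (_- 1ℤ) (ℤ.^-distribˡ-+-* (+ 2) n n) ⟩
  (+ 2) ^ n ℤ.* (+ 2) ^ n - 1ℤ    ∎

difference-of-squares : ∀ x u → u ℤ.* u ≡ 1ℤ → x ℤ.* x - 1ℤ ≡ (x - u) ℤ.* (x + u)
difference-of-squares x u u²≡1 =
  trans (cong (λ v → x ℤ.* x - v) (sym u²≡1)) (factor x u)
  where
  factor : ∀ x u → x ℤ.* x - u ℤ.* u ≡ (x - u) ℤ.* (x + u)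
  factor = solve-∀

-- Since `u^2 = 1`, the 1 in `x^2 - 1` may be read as `u^2`; the two factors are then exactly the
-- denominators of `J⁽ k ⁾` and `j⁽ k ⁾`.
M-double-factor : ∀ k → M (2 ℕ.* k) ≡ ((+ 2) ^ k - -1ℤ ^ k) ℤ.* ((+ 2) ^ k + -1ℤ ^ k)
M-double-factor k = trans (M-double k)
  (difference-of-squares ((+ 2) ^ k) (-1ℤ ^ k) ([-1]^n*[-1]^n≡1 k))

-- The same factorization at `k ℕ.* n` yields the two numerators.
M-double-factor-^ : ∀ k n → M (2 ℕ.* k ℕ.* n) ≡
  (((+ 2) ^ k) ^ n - (-1ℤ ^ k) ^ n) ℤ.* (((+ 2) ^ k) ^ n + (-1ℤ ^ k) ^ n)
M-double-factor-^ k n = begin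
  M (2 ℕ.* k ℕ.* n)    ≡⟨ cong M (ℕ.*-assoc 2 k n) ⟩
  M (2 ℕ.* (k ℕ.* n))  ≡⟨ M-double-factor (k ℕ.* n) ⟩
  ((+ 2) ^ (k ℕ.* n) - -1ℤ ^ (k ℕ.* n)) ℤ.* ((+ 2) ^ (k ℕ.* n) + -1ℤ ^ (k ℕ.* n))
    ≡⟨ cong₂ (λ x u → (x - u) ℤ.* (x + u)) (ℤ.^-*-assoc (+ 2) k n) (ℤ.^-*-assoc -1ℤ k n) ⟨
  (((+ 2) ^ k) ^ n - (-1ℤ ^ k) ^ n) ℤ.* (((+ 2) ^ k) ^ n + (-1ℤ ^ k) ^ n) ∎

module _ (k : ℕ) .{{_ : NonZero k}} (n : ℕ) where

  private
    x xⁿ u : ℤ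
    x  = (+ 2) ^ k
    xⁿ = x ^ n
    u  = -1ℤ ^ k

    instance
      M-nonZero : ℤ.NonZero (M k)
      M-nonZero = M≢0 k

      x-1-nonZero : ℤ.NonZero (x - 1ℤ)
      x-1-nonZero = 2^k-1≢0 k

      x-u-nonZero : ℤ.NonZero (x - u)
      x-u-nonZero = 2^k-[-1]^k≢0 k

      x+u-nonZero : ℤ.NonZero (x + u)
      x+u-nonZero = 2^k+[-1]^k≢0 k

  -- Here `u = 1`, hence `u^n = 1` for `n` of either parity.
  M⁽⁾≡J⁽⁾ : 2 ∣ k → M⁽ k ⁾ n ≡ J⁽ k ⁾ n
  M⁽⁾≡J⁽⁾ 2∣k = ⁄-cong
    (trans (M-* k n) (cong (xⁿ -_) (sym (trans (cong (_^ n) u≡1) (ℤ.^-zeroˡ n)))))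
    (trans (M-closed k) (cong (x -_) (sym u≡1)))
    where
    u≡1 : u ≡ 1ℤ
    u≡1 = [-1]^even 2∣k

  M⁽⁾≡j⁽⁾ : 2 ∤ n → 2 ∤ k → M⁽ k ⁾ n ≡ j⁽ k ⁾ n
  M⁽⁾≡j⁽⁾ 2∤n 2∤k = ⁄-cong
    -- Subtracting `1ℤ` unfolds to adding `-1ℤ`, and `-1ℤ` is the value of both `u` and `u^n`.
    (trans (M-* k n) (cong (λ v → xⁿ + v) (sym (trans (cong (_^ n) u≡-1) ([-1]^odd n 2∤n)))))
    (trans (M-closed k) (cong (λ v → x + v) (sym u≡-1)))
    where
    u≡-1 : u ≡ -1ℤ
    u≡-1 = [-1]^odd k 2∤k

  M⁽⁾≡c*J⁽⁾ : 2 ∣ n → 2 ∤ k → M⁽ k ⁾ n ≡ ((x + 1ℤ) ⁄ (x - 1ℤ)) * J⁽ k ⁾ n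
  M⁽⁾≡c*J⁽⁾ 2∣n 2∤k = begin
    M⁽ k ⁾ n
      ≡⟨ ⁄-cross (M (k ℕ.* n)) (M k) ((x + 1ℤ) ℤ.* (xⁿ - u ^ n)) ((x - 1ℤ) ℤ.* (x - u))
           {{M≢0 k}} {{ℤ.i*j≢0 (x - 1ℤ) (x - u)}} cross ⟩
    (((x + 1ℤ) ℤ.* (xⁿ - u ^ n)) ⁄ ((x - 1ℤ) ℤ.* (x - u))) {{ℤ.i*j≢0 (x - 1ℤ) (x - u)}}
      ≡⟨ ⁄-* (x + 1ℤ) (x - 1ℤ) (xⁿ - u ^ n) (x - u) ⟨
    ((x + 1ℤ) ⁄ (x - 1ℤ)) * J⁽ k ⁾ n ∎
    where
    u≡-1 : u ≡ -1ℤ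
    u≡-1 = [-1]^odd k 2∤k

    uⁿ≡1 : u ^ n ≡ 1ℤ
    uⁿ≡1 = trans (cong (_^ n) u≡-1) ([-1]^even 2∣n)

    rearrange : ∀ x y → (y - 1ℤ) ℤ.* ((x - 1ℤ) ℤ.* (x + 1ℤ)) ≡ (x + 1ℤ) ℤ.* (y - 1ℤ) ℤ.* (x - 1ℤ)
    rearrange = solve-∀

    cross : M (k ℕ.* n) ℤ.* ((x - 1ℤ) ℤ.* (x - u)) ≡ (x + 1ℤ) ℤ.* (xⁿ - u ^ n) ℤ.* M k
    cross = begin
      M (k ℕ.* n) ℤ.* ((x - 1ℤ) ℤ.* (x - u))
        -- At `v = -1ℤ` the factor `x - v` computes to `x + 1ℤ`.
        ≡⟨ cong₂ (λ m v → m ℤ.* ((x - 1ℤ) ℤ.* (x - v))) (M-* k n) u≡-1 ⟩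
      (xⁿ - 1ℤ) ℤ.* ((x - 1ℤ) ℤ.* (x + 1ℤ))
        ≡⟨ rearrange x xⁿ ⟩
      (x + 1ℤ) ℤ.* (xⁿ - 1ℤ) ℤ.* (x - 1ℤ)
        ≡⟨ cong₂ (λ v m → (x + 1ℤ) ℤ.* (xⁿ - v) ℤ.* m) uⁿ≡1 (M-closed k) ⟨
      (x + 1ℤ) ℤ.* (xⁿ - u ^ n) ℤ.* M k ∎

  M⁽2k⁾≡J⁽⁾*j⁽⁾ : M⁽_⁾ (2 ℕ.* k) {{m*n≢0 2 k}} n ≡ J⁽ k ⁾ n * j⁽ k ⁾ n
  M⁽2k⁾≡J⁽⁾*j⁽⁾ = trans
    (⁄-cong {{M≢0 (2 ℕ.* k) {{m*n≢0 2 k}}}} {{ℤ.i*j≢0 (x - u) (x + u)}}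
      (M-double-factor-^ k n) (M-double-factor k))
    (sym (⁄-* (xⁿ - u ^ n) (x - u) (xⁿ + u ^ n) (x + u)))

theorem2p15 : ∀ (k : ℕ) .{{_ : NonZero k}} (n : ℕ) →
    (2 ∣ n →
    (2 ∣ k → M⁽ k ⁾ n ≡ J⁽ k ⁾ n) ×
    (2 ∤ k → M⁽ k ⁾ n ≡ (((+ 2) ^ k + 1ℤ) ⁄ ((+ 2) ^ k - 1ℤ)) {{2^k-1≢0 k}} * J⁽ k ⁾ n)) ×
    (2 ∤ n →
    (2 ∣ k → M⁽ k ⁾ n ≡ J⁽ k ⁾ n) ×
    (2 ∤ k → M⁽ k ⁾ n ≡ j⁽ k ⁾ n)) ×
    (M⁽_⁾ (2 ℕ.* k) {{m*n≢0 2 k}} n ≡ J⁽ k ⁾ n * j⁽ k ⁾ n)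
theorem2p15 k n =
  (λ 2∣n → M⁽⁾≡J⁽⁾ k n , M⁽⁾≡c*J⁽⁾ k n 2∣n) ,
  (λ 2∤n → M⁽⁾≡J⁽⁾ k n , M⁽⁾≡j⁽⁾ k n 2∤n) ,
  M⁽2k⁾≡J⁽⁾*j⁽⁾ k n
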